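{- Let $D$ be an inhabited algebraic dcpo with basis of compact elements $B_D$ and let $E$ be a pointed bounded complete algebraic dcpo with basis of compact elements $B_E$. Let $B$ be the set of all $\bigsqcup S$, where $S$ is a bounded (in $E^D$) Kuratowski finite subset of single-step functions of the form $(a\Rightarrow b)$ with $a\in B_D$ and $b\in B_E$. Then the exponential $E^D$ is algebraic and $B$ is its basis of compact elements. Moreover, if for every $b\in B_E$ it is decidable whether $b=\bot$, then for every $f\in B$ it is decidable whether $f=\bot$. Finally, if for every $a,b\in B_D$ it is decidable whether $a\sqsubseteq b$ and for every $a,b\in B_E$ it is decidable whether $a\sqsubseteq b$ (equivalently, these conditions with $\ll$ in place of $\sqsubseteq$), then for every $f,g\in B$ it is decidable whether $f\sqsubseteq g$, and for every $f,g\in B$ it is decidable whether $f\ll g$.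
   Context: Everything is constructive: neither excluded middle nor choice is assumed. A proposition $P$ is decidable if $P\vee\lnot P$ holds. A subset $S$ of a poset is semidirected if any two elements of $S$ have an upper bound in $S$, and directed if moreover it is inhabited. A dcpo is a poset $(D,\sqsubseteq)$ in which every directed subset $S$ has a supremum $\bigsqcup S$; it is pointed if it has a least element $\bot$ (then all semidirected subsets have suprema). Write $x\ll y$ if for every directed $S$ with $y\sqsubseteq\bigsqcup S$ there is $s\in S$ with $x\sqsubseteq s$; $c$ is compact if $c\ll c$. $D$ is algebraic if for every $x\in D$ the set $\{c\in D\mid c\sqsubseteq x,\ c\text{ compact}\}$ is directed with supremum $x$; its basis of compact elements is the set of all compact elements. A subset of a poset is bounded if it has an upper bound; a poset is bounded complete if every bounded subset has a supremum. A set $X$ is Kuratowski finite if there is a surjection $\{0,\dots,n-1\}\to X$ for some $n\in\mathbb N$. A function between dcpos is Scott continuous if it preserves directed suprema. The exponential $E^D$ is the dcpo of Scott continuous functions $D\to E$ with the pointwise order and pointwise directed suprema. For $x\in D$ and $y\in E$ ($E$ pointed), the single-step function $(x\Rightarrow y)\colon D\to E$ is $(x\Rightarrow y)(d)=\bigsqcup\{y\mid x\sqsubseteq d\}$, where $\{y\mid x\sqsubseteq d\}$ is the (semidirected) set whose elements are those $w$ with $w=y$ and $x\sqsubseteq d$ true; it is Scott continuous when $x$ is compact. -}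

-- Size conventions.  A subset of a poset is presented either as a predicate or
-- as the range of a family α : I → Carrier; a predicate S is the range of the
-- family  members S.  On a poset with carrier in Set v, families indexed by
-- types in Set v and predicates valued in Set v present the same subsets.
-- Families are used for directed subsets because the exponential of two dcpos
-- with carriers in Set v has its carrier in Set (suc v), while its (pointwise)
-- suprema are still taken over index types in Set v.
--
-- Quantification over all directed (or all bounded) subsets ranges over
-- families indexed by types in Set v.  Being directed and being a least upper
-- bound are defined for families of every size, so that the subset of compact
-- elements below a given element needs no smallness condition.
--
-- Equality of elements is the equality _≈_ of the poset.

module Defs where

open import Data.Bool.Base using (Bool; true; false)
open import Data.Fin.Base using (Fin)
open import Data.Maybe.Base using (Maybe; just; nothing; maybe′)
open import Data.Product.Base using (Σ; Σ-syntax; ∃-syntax; _×_; _,_; proj₁; proj₂)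
open import Function.Base using (_∘_)
open import Function.Bundles using (_⇔_; Equivalence)
open import Level using (Level; _⊔_; suc; Lift; lift)
open import Relation.Binary.Bundles using (Poset)
open import Relation.Binary.Core using (Rel)
open import Relation.Binary.Definitions using (Minimum)
open import Relation.Nullary.Decidable.Core using (Dec)
open import Relation.Unary using (Pred; _∈_)

members : ∀ {a ℓ} {A : Set a} (S : Pred A ℓ) → Σ A S → A
members S = proj₁

DecidableOn : ∀ {a ℓ r} {A : Set a} → Pred A ℓ → Rel A r → Set (a ⊔ ℓ ⊔ r)
DecidableOn S _~_ = ∀ x y → x ∈ S → y ∈ S → Dec (x ~ y)

module Order {o e ℓ} (P : Poset o e ℓ) where

  open Poset P renaming (_≤_ to _⊑_)

  IsUpperBound : ∀ {i} {I : Set i} → Carrier → (I → Carrier) → Set (i ⊔ ℓ)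
  IsUpperBound u α = ∀ i → α i ⊑ u

  IsLub : ∀ {i} {I : Set i} → Carrier → (I → Carrier) → Set (o ⊔ i ⊔ ℓ)
  IsLub x α = IsUpperBound x α × (∀ u → IsUpperBound u α → x ⊑ u)

  IsBounded : ∀ {i} {I : Set i} → (I → Carrier) → Set (o ⊔ i ⊔ ℓ)
  IsBounded α = ∃[ u ] IsUpperBound u α

  IsSemidirected : ∀ {i} {I : Set i} → (I → Carrier) → Set (i ⊔ ℓ)
  IsSemidirected α = ∀ i j → ∃[ k ] (α i ⊑ α k × α j ⊑ α k)

  IsDirected : ∀ {i} {I : Set i} → (I → Carrier) → Set (i ⊔ ℓ)
  IsDirected {I = I} α = I × IsSemidirected α

  IsKuratowskiFinite : ∀ {s} → Pred Carrier s → Set (o ⊔ e ⊔ s)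
  IsKuratowskiFinite S =
    ∃[ n ] Σ[ enum ∈ (Fin n → Carrier) ]
      ((∀ k → enum k ∈ S) × (∀ x → x ∈ S → ∃[ k ] enum k ≈ x))

record DCPO (o v : Level) : Set (suc (o ⊔ v)) where
  field
    poset : Poset o v v

  open Poset poset public renaming (_≤_ to _⊑_)
  open Order poset public

  field
    ⋁       : {I : Set v} (α : I → Carrier) → IsDirected α → Carrier
    ⋁-isLub : {I : Set v} (α : I → Carrier) (δ : IsDirected α) → IsLub (⋁ α δ) α

  _≪_ : Carrier → Carrier → Set (o ⊔ suc v)
  x ≪ y = {I : Set v} (α : I → Carrier) (δ : IsDirected α) →
          y ⊑ ⋁ α δ → ∃[ i ] x ⊑ α i

  IsCompact : Carrier → Set (o ⊔ suc v)
  IsCompact c = c ≪ c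

  CompactBelow : Carrier → Pred Carrier (o ⊔ suc v)
  CompactBelow x c = c ⊑ x × IsCompact c

  IsAlgebraic : Set (o ⊔ suc v)
  IsAlgebraic = ∀ x → IsDirected (members (CompactBelow x))
                    × IsLub x (members (CompactBelow x))

  IsCompactBasis : ∀ {b} → Pred Carrier b → Set (o ⊔ suc v ⊔ b)
  IsCompactBasis B = ∀ c → c ∈ B ⇔ IsCompact c

  IsBoundedComplete : Set (o ⊔ suc v)
  IsBoundedComplete = {I : Set v} (α : I → Carrier) → IsBounded α → ∃[ x ] IsLub x α

  IsPointed : Set (o ⊔ v)
  IsPointed = ∃[ ⊥ ] Minimum _⊑_ ⊥

module _ {o v} (D : DCPO o v) (pointed : DCPO.IsPointed D) where

  open DCPO D

  private
    ⊥ = proj₁ pointed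

    adjoin : {I : Set v} → (I → Carrier) → Maybe I → Carrier
    adjoin α = maybe′ α ⊥

    adjoin-directed : {I : Set v} (α : I → Carrier) →
                      IsSemidirected α → IsDirected (adjoin α)
    adjoin-directed α σ = nothing , λ where
      nothing  j        → j , proj₂ pointed _ , refl
      (just i) nothing  → just i , refl , proj₂ pointed _
      (just i) (just j) → let k , p , q = σ i j in just k , p , q

  semi⋁ : {I : Set v} (α : I → Carrier) → IsSemidirected α → Carrier
  semi⋁ α σ = ⋁ (adjoin α) (adjoin-directed α σ)

  semi⋁-isLub : {I : Set v} (α : I → Carrier) (σ : IsSemidirected α) →
                IsLub (semi⋁ α σ) α
  semi⋁-isLub α σ with ⋁-isLub (adjoin α) (adjoin-directed α σ)
  ... | upper , least = (λ i → upper (just i)) , λ u bound → least u λ where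
    nothing  → proj₂ pointed u
    (just i) → bound i

module _ {o o′ v} (D : DCPO o v) (E : DCPO o′ v) where

  private
    module D = DCPO D
    module E = DCPO E

  -- Monotonicity is not assumed: it follows from preservation of the supremum
  -- of a two-element chain.
  IsScottContinuous : (D.Carrier → E.Carrier) → Set (o ⊔ o′ ⊔ suc v)
  IsScottContinuous f = {I : Set v} (α : I → D.Carrier) → D.IsDirected α →
                        ∀ x → D.IsLub x α → E.IsLub (f x) (f ∘ α)

  record ScottContinuous : Set (o ⊔ o′ ⊔ suc v) where
    constructor scott
    field
      apply      : D.Carrier → E.Carrier
      continuous : IsScottContinuous apply

  open ScottContinuous

  scott-mono : (f : ScottContinuous) → ∀ {x y} → x D.⊑ y → apply f x E.⊑ apply f y
  scott-mono f {x} {y} x⊑y = proj₁ (continuous f chain directed y isLub) (lift true)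
    where
    chain : Lift v Bool → D.Carrier
    chain (lift true)  = x
    chain (lift false) = y

    below : ∀ i → chain i D.⊑ y
    below (lift true)  = x⊑y
    below (lift false) = D.refl

    directed : D.IsDirected chain
    directed = lift false , λ i j → lift false , below i , below j

    isLub : D.IsLub y chain
    isLub = below , λ u bound → bound (lift false)

module _ {o o′ v} (E : DCPO o′ v) (D : DCPO o v) where

  private
    module D = DCPO D
    module E = DCPO E

  open ScottContinuous

  pointwisePoset : Poset (o ⊔ o′ ⊔ suc v) (o ⊔ v) (o ⊔ v)
  pointwisePoset = record
    { Carrier        = ScottContinuous D E
    ; _≈_            = λ f g → ∀ d → apply f d E.≈ apply g d
    ; _≤_            = λ f g → ∀ d → apply f d E.⊑ apply g d
    ; isPartialOrder = record
      { isPreorder = record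
        { isEquivalence = record
          { refl  = λ d → E.Eq.refl
          ; sym   = λ p d → E.Eq.sym (p d)
          ; trans = λ p q d → E.Eq.trans (p d) (q d)
          }
        ; reflexive = λ p d → E.reflexive (p d)
        ; trans     = λ p q d → E.trans (p d) (q d)
        }
      ; antisym = λ p q d → E.antisym (p d) (q d)
      }
    }

module _ {v} (E D : DCPO v v) where

  private
    module D = DCPO D
    module E = DCPO E
    module P = Order (pointwisePoset E D)

  open ScottContinuous

  private
    at : {I : Set v} → (I → ScottContinuous D E) → D.Carrier → I → E.Carrier
    at F d i = apply (F i) d

    at-directed : {I : Set v} (F : I → ScottContinuous D E) →
                  P.IsDirected F → ∀ d → E.IsDirected (at F d)
    at-directed F (i₀ , σ) d = i₀ , λ i j → let k , p , q = σ i j in k , p d , q d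

    ⋁ᵖ : {I : Set v} (F : I → ScottContinuous D E) → P.IsDirected F → ScottContinuous D E
    ⋁ᵖ F δ = scott (λ d → E.⋁ (at F d) (at-directed F δ d)) λ α dir x x-lub →
        (λ j → proj₂ (lub (α j)) _ λ i →
          E.trans (scott-mono D E (F i) (proj₁ x-lub j)) (proj₁ (lub x) i))
      , (λ u bound → proj₂ (lub x) u λ i →
          proj₂ (continuous (F i) α dir x x-lub) u λ j →
            E.trans (proj₁ (lub (α j)) i) (bound j))
      where
      lub = λ d → E.⋁-isLub (at F d) (at-directed F δ d)

  infixl 8 _^_

  _^_ : DCPO (suc v) v
  _^_ = record
    { poset   = pointwisePoset E D
    ; ⋁       = ⋁ᵖ
    ; ⋁-isLub = λ F δ →
          (λ i d → proj₁ (E.⋁-isLub (at F d) (at-directed F δ d)) i)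
        , (λ g bound d → proj₂ (E.⋁-isLub (at F d) (at-directed F δ d)) (apply g d)
                           λ i → bound i d)
    }

  ^-pointed : E.IsPointed → DCPO.IsPointed _^_
  ^-pointed (⊥ , minimum) = const⊥ , λ f d → minimum (apply f d)
    where
    const⊥ : ScottContinuous D E
    const⊥ = scott (λ _ → ⊥) λ α δ x _ → (λ _ → E.refl) , λ u bound → bound (proj₁ δ)

module _ {v} (D E : DCPO v v) (pointed : DCPO.IsPointed E) where

  private
    module D = DCPO D
    module E = DCPO E
    module Exp = DCPO (E ^ D)

  -- The family indexed by (proofs of) a ⊑ d with constant value b presents the
  -- subset { b | a ⊑ d }.
  private
    const-semidirected : ∀ {a d} (b : E.Carrier) →
                         E.IsSemidirected {I = a D.⊑ d} (λ _ → b)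
    const-semidirected b p q = p , E.refl , E.refl

  stepValue : D.Carrier → E.Carrier → D.Carrier → E.Carrier
  stepValue a b d =
    semi⋁ E pointed {I = a D.⊑ d} (λ _ → b) (const-semidirected {a} {d} b)

  singleStep : (a : D.Carrier) → D.IsCompact a → E.Carrier → Exp.Carrier
  singleStep a a≪a b = scott (stepValue a b) λ α δ x x-lub →
      (λ i → proj₂ (lub (α i)) _ λ p → proj₁ (lub x) (D.trans p (proj₁ x-lub i)))
    , (λ u bound → proj₂ (lub x) u λ p →
        let a⊑⋁α     = D.trans p (proj₂ x-lub _ (proj₁ (D.⋁-isLub α δ)))
            i , a⊑αi = a≪a α δ a⊑⋁α
        in E.trans (proj₁ (lub (α i)) a⊑αi) (bound i))
    where
    lub : ∀ d → E.IsLub (stepValue a b d) (λ (_ : a D.⊑ d) → b)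
    lub d = semi⋁-isLub E pointed (λ _ → b) (const-semidirected {a} {d} b)

  module _ (B-D : Pred D.Carrier v) (B-D-basis : D.IsCompactBasis B-D)
           (B-E : Pred E.Carrier v) where

    IsSingleStep : Pred Exp.Carrier v
    IsSingleStep f =
      ∃[ a ] Σ[ a∈B ∈ a ∈ B-D ] ∃[ b ]
        (b ∈ B-E × f Exp.≈ singleStep a (Equivalence.to (B-D-basis a) a∈B) b)

    StepJoins : Pred Exp.Carrier (suc v)
    StepJoins f =
      Σ[ S ∈ Pred Exp.Carrier v ]
        ( (∀ g → g ∈ S → IsSingleStep g)
        × Exp.IsKuratowskiFinite S
        × Exp.IsBounded (members S)
        × Exp.IsLub f (members S) )

-- A single step (a ⇒ b) lies below a Scott continuous g exactly when b ⊑ g a.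
-- Hence (a ⇒ b) is compact when a and b are, and finite joins of compact
-- elements are compact.  Conversely, every f is the supremum of the single
-- steps below it; the finite joins of these form a directed family, so if f is
-- compact it is itself such a finite join.
--
-- For f = ⋁ₖ (aₖ ⇒ bₖ), the inequality f ⊑ g means bₖ ⊑ g aₖ for all k.  If g is
-- also a finite join of single steps (c ⇒ e), then g aₖ is the join of the
-- elements e with c ⊑ aₖ; deciding these conditions makes it a finite join of
-- compact elements, so bₖ ⊑ g aₖ is an inequality in the basis of E.

module Submission where

open import Defs
open import Data.Empty using (⊥-elim)
open import Data.Fin.Base using (Fin; zero; suc; _↑ˡ_; _↑ʳ_)
open import Data.Fin.Properties using (all?)
open import Data.Nat.Base using (ℕ; zero; suc; _+_)
open import Data.Product.Base
  using (Σ; Σ-syntax; ∃-syntax; _×_; _,_; proj₁; proj₂)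
open import Data.Unit.Base using (⊤; tt)
open import Data.Vec.Functional using (_++_; []; _∷_)
open import Data.Vec.Functional.Properties using (lookup-++ˡ; lookup-++ʳ)
open import Function.Base using (_∘_)
open import Function.Bundles using (_⇔_; mk⇔; Equivalence)
open import Level using (Level; Lift; lift; lower)
open import Relation.Binary.Bundles using (Poset)
open import Relation.Binary.PropositionalEquality.Core using (_≡_; cong; sym)
open import Relation.Nullary.Decidable using (map)
open import Relation.Nullary.Decidable.Core using (Dec; yes; no)
open import Relation.Unary using (Pred; _∈_)

open Equivalence using (to; from)

-- Least upper bounds and finite subfamilies of directed families.

module OrderProperties {o e ℓ} (P : Poset o e ℓ) where

  open Poset P renaming (_≤_ to _⊑_)
  open Order P

  lub-resp-≈ : ∀ {i} {I : Set i} {α : I → Carrier} {x y} →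
               x ≈ y → IsLub x α → IsLub y α
  lub-resp-≈ x≈y (upper , least) =
      (λ i → trans (upper i) (reflexive x≈y))
    , (λ u bound → trans (reflexive (Eq.sym x≈y)) (least u bound))

  lub-unique : ∀ {i} {I : Set i} {α : I → Carrier} {x y} →
               IsLub x α → IsLub y α → x ≈ y
  lub-unique (upper , least) (upper′ , least′) =
    antisym (least _ upper′) (least′ _ upper)

  finite-upper-bound : ∀ {i} {I : Set i} (α : I → Carrier) → IsDirected α →
                       ∀ n (js : Fin n → I) → ∃[ i ] (∀ k → α (js k) ⊑ α i)
  finite-upper-bound α (i₀ , σ) zero    js = i₀ , λ ()
  finite-upper-bound α (i₀ , σ) (suc n) js =
    let j , bound = finite-upper-bound α (i₀ , σ) n (js ∘ suc)
        k , p , q = σ (js zero) j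
    in k , λ where
      zero    → p
      (suc l) → trans (bound l) q

-- Compact elements and compact bases.

module DCPOProperties {o v} (D : DCPO o v) where

  open DCPO D
  open OrderProperties poset

  compact-resp-≈ : ∀ {x y} → x ≈ y → IsCompact x → IsCompact y
  compact-resp-≈ x≈y x≪x α δ y⊑⋁α =
    let i , x⊑αi = x≪x α δ (trans (reflexive x≈y) y⊑⋁α)
    in i , trans (reflexive (Eq.sym x≈y)) x⊑αi

  ⊑⇔≪ : ∀ {x} y → IsCompact x → x ⊑ y ⇔ x ≪ y
  ⊑⇔≪ {x} y x≪x = mk⇔ ⊑⇒≪ ≪⇒⊑
    where
    ⊑⇒≪ : x ⊑ y → x ≪ y
    ⊑⇒≪ x⊑y α δ y⊑⋁α = x≪x α δ (trans x⊑y y⊑⋁α)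

    -- Testing `x ≪ y` on the one-element directed family at `y` recovers `x ⊑ y`.
    singleton : Lift v ⊤ → Carrier
    singleton _ = y

    singleton-directed : IsDirected singleton
    singleton-directed = lift tt , λ i j → i , refl , refl

    ≪⇒⊑ : x ≪ y → x ⊑ y
    ≪⇒⊑ x≪y = proj₂ (x≪y singleton singleton-directed
      (proj₁ (⋁-isLub singleton singleton-directed) (lift tt)))

  decidable-⊑⇔≪ : ∀ {b} (B : Pred Carrier b) → IsCompactBasis B →
                  DecidableOn B _⊑_ ⇔ DecidableOn B _≪_
  decidable-⊑⇔≪ B basis = mk⇔
    (λ _⊑?_ x y x∈B y∈B → map (⊑⇔≪ y (to (basis x) x∈B)) ((x ⊑? y) x∈B y∈B))
    (λ _≪?_ x y x∈B y∈B → map (≪⇔⊑ y (to (basis x) x∈B)) ((x ≪? y) x∈B y∈B))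
    where
    ≪⇔⊑ : ∀ {x} y → IsCompact x → x ≪ y ⇔ x ⊑ y
    ≪⇔⊑ y x≪x = mk⇔ (from (⊑⇔≪ y x≪x)) (to (⊑⇔≪ y x≪x))

  -- Compactness of each `α k` yields one index of `β` per `k`; directedness merges these finitely
  -- many indices into one. The case of no indices makes a least element compact.
  finite-lub-compact : ∀ {n x} (α : Fin n → Carrier) → IsLub x α →
                       (∀ k → IsCompact (α k)) → IsCompact x
  finite-lub-compact {n} α (upper , least) compact β δ x⊑⋁β =
    let below     = λ k → compact k β δ (trans (upper k) x⊑⋁β)
        i , bound = finite-upper-bound β δ n (proj₁ ∘ below)
    in i , least (β i) λ k → trans (proj₂ (below k)) (bound k)

  module _ {b} {B : Pred Carrier b} (basis : IsCompactBasis B)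
           (algebraic : IsAlgebraic) where

    -- `CompactBelow` lives in a universe too large to index a family to which Scott continuity
    -- applies. Membership in `B` replaces compactness, so that the index type is in `Set v` when
    -- the carrier and `B` are.
    BasisBelow : Carrier → Pred Carrier _
    BasisBelow x c = c ⊑ x × c ∈ B

    basis-directed : ∀ x → IsDirected (members (BasisBelow x))
    basis-directed x with proj₁ (algebraic x)
    ... | (c , c⊑x , c≪c) , σ =
      (c , c⊑x , from (basis c) c≪c) , λ (a , a⊑x , a∈B) (b , b⊑x , b∈B) →
        let (k , k⊑x , k≪k) , a⊑k , b⊑k =
              σ (a , a⊑x , to (basis a) a∈B) (b , b⊑x , to (basis b) b∈B)
        in (k , k⊑x , from (basis k) k≪k) , a⊑k , b⊑k

    basis-lub : ∀ x → IsLub x (members (BasisBelow x))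
    basis-lub x = (λ (_ , c⊑x , _) → c⊑x) , λ u bound →
      proj₂ (proj₂ (algebraic x)) u λ (c , c⊑x , c≪c) →
        bound (c , c⊑x , from (basis c) c≪c)

-- Finite joins and single steps in the exponential.

module _ {v} (D E : DCPO v v) where

  private
    module D = DCPO D
    module E where
      open DCPO E public
      open OrderProperties poset public
    module E^D where
      open DCPO (E ^ D) public
      open OrderProperties poset public

  open ScottContinuous

  module FiniteJoins (E-boundedComplete : E.IsBoundedComplete) where

    finite-lub : ∀ {n} (α : Fin n → E.Carrier) → E.IsBounded α → ∃[ x ] E.IsLub x α
    finite-lub α (u , α⊑u) =
      let x , upper , least = E-boundedComplete (α ∘ lower {ℓ = v}) (u , α⊑u ∘ lower)
      in x , upper ∘ lift , λ w bound → least w (bound ∘ lower)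

    module _ {n} (F : Fin n → E^D.Carrier) (bounded : E^D.IsBounded F) where

      private
        lubAt : ∀ d → ∃[ x ] E.IsLub x (λ k → apply (F k) d)
        lubAt d = finite-lub (λ k → apply (F k) d)
                             (apply (proj₁ bounded) d , λ k → proj₂ bounded k d)

      join : E^D.Carrier
      join = scott (proj₁ ∘ lubAt) λ α δ x x-lub →
          (λ i → proj₂ (proj₂ (lubAt (α i))) _ λ k →
            E.trans (scott-mono D E (F k) (proj₁ x-lub i)) (proj₁ (proj₂ (lubAt x)) k))
        , (λ u bound → proj₂ (proj₂ (lubAt x)) u λ k →
            proj₂ (continuous (F k) α δ x x-lub) u λ i →
              E.trans (proj₁ (proj₂ (lubAt (α i))) k) (bound i))

      join-isLub : E^D.IsLub join F
      join-isLub = (λ k d → proj₁ (proj₂ (lubAt d)) k)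
                 , (λ u bound d → proj₂ (proj₂ (lubAt d)) _ λ k → bound k d)

      -- The pointwise join is itself a supremum of `F`, so by uniqueness every supremum of `F`
      -- agrees with it at each point.
      lub-pointwise : ∀ {f} → E^D.IsLub f F →
                      ∀ d → E.IsLub (apply f d) (λ k → apply (F k) d)
      lub-pointwise {f} f-lub d =
        E.lub-resp-≈ (E^D.lub-unique {α = F} {join} {f} join-isLub f-lub d)
                     (proj₂ (lubAt d))

  module SingleSteps (E-pointed : E.IsPointed) where

    stepValue-isLub : ∀ a b d →
      E.IsLub (stepValue D E E-pointed a b d) (λ (_ : a D.⊑ d) → b)
    stepValue-isLub a b d =
      semi⋁-isLub E E-pointed (λ _ → b) (λ p _ → p , E.refl , E.refl)

    -- Deciding `a ⊑ d` turns the family of copies of `b` into an enumerated one with one member or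
    -- none, so its supremum is a finite join of compact elements.
    stepValue-compact : ∀ a b d → Dec (a D.⊑ d) → E.IsCompact b →
                        E.IsCompact (stepValue D E E-pointed a b d)
    stepValue-compact a b d (yes a⊑d) b≪b =
      DCPOProperties.finite-lub-compact E (b ∷ [])
        ( (λ where zero → proj₁ (stepValue-isLub a b d) a⊑d)
        , (λ u bound → proj₂ (stepValue-isLub a b d) u λ _ → bound zero))
        (λ where zero → b≪b)
    stepValue-compact a b d (no a⋢d) b≪b =
      DCPOProperties.finite-lub-compact E []
        ((λ ()) , λ u _ → proj₂ (stepValue-isLub a b d) u (⊥-elim ∘ a⋢d))
        (λ ())

    -- Evaluation at `a` gives one direction; monotonicity of `g` from `a` to any `d` above it gives
    -- the other.
    singleStep-⊑⇔ : ∀ a (a≪a : D.IsCompact a) b g →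
      singleStep D E E-pointed a a≪a b E^D.⊑ g ⇔ b E.⊑ apply g a
    singleStep-⊑⇔ a a≪a b g = mk⇔
      (λ step⊑g → E.trans (proj₁ (stepValue-isLub a b a) D.refl) (step⊑g a))
      (λ b⊑ga d → proj₂ (stepValue-isLub a b d) _ λ a⊑d →
        E.trans b⊑ga (scott-mono D E g a⊑d))

    singleStep-compact : ∀ a (a≪a : D.IsCompact a) b → E.IsCompact b →
                         E^D.IsCompact (singleStep D E E-pointed a a≪a b)
    singleStep-compact a a≪a b b≪b F δ step⊑⋁F =
      let i , b⊑Fia = b≪b (λ i → apply (F i) a)
                        -- This directedness proof is definitionally the one inside the pointwise
                        -- supremum, so the supremum in `E` is the value of `E^D.⋁ F δ` at `a`.
                        (proj₁ δ , λ i j → let k , p , q = proj₂ δ i j in k , p a , q a)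
                        (to (singleStep-⊑⇔ a a≪a b (E^D.⋁ F δ)) step⊑⋁F)
      in i , from (singleStep-⊑⇔ a a≪a b (F i)) b⊑Fia

-- Steps between basis elements and approximation by them.

module Exponential
  {v} (D E : DCPO v v)
  (D-algebraic : DCPO.IsAlgebraic D)
  (B-D : Pred (DCPO.Carrier D) v) (B-D-basis : DCPO.IsCompactBasis D B-D)
  (E-pointed : DCPO.IsPointed E) (E-boundedComplete : DCPO.IsBoundedComplete E)
  (E-algebraic : DCPO.IsAlgebraic E)
  (B-E : Pred (DCPO.Carrier E) v) (B-E-basis : DCPO.IsCompactBasis E B-E)
  where

  private
    module D = DCPO D
    module E = DCPO E
    module D′ = DCPOProperties D
    module E′ = DCPOProperties E
    module E^D where
      open DCPO (E ^ D) public
      open DCPOProperties (E ^ D) public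

    B : Pred E^D.Carrier _
    B = StepJoins D E E-pointed B-D B-D-basis B-E

    ⊥-E = proj₁ E-pointed
    ⊥-E^D = proj₁ (^-pointed E D E-pointed)

    ⊥-minimum : ∀ x → ⊥-E E.⊑ x
    ⊥-minimum = proj₂ E-pointed

  open ScottContinuous
  open FiniteJoins D E E-boundedComplete
  open SingleSteps D E E-pointed

  -- Codes for single steps stay in `Set v`, unlike the functions they denote, so finite lists of
  -- them can index a directed family in the exponential.
  record Step : Set v where
    constructor step
    field
      source   : D.Carrier
      source∈B : source ∈ B-D
      target   : E.Carrier
      target∈B : target ∈ B-E

    source-compact : D.IsCompact source
    source-compact = to (B-D-basis source) source∈B

    target-compact : E.IsCompact target
    target-compact = to (B-E-basis target) target∈B

    ⟦_⟧ : E^D.Carrier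
    ⟦_⟧ = singleStep D E E-pointed source source-compact target

  open Step

  _Below_ : Step → E^D.Carrier → Set v
  s Below f = target s E.⊑ apply f (source s)

  ⟦⟧⊑⇔Below : ∀ s f → ⟦ s ⟧ E^D.⊑ f ⇔ s Below f
  ⟦⟧⊑⇔Below s f = singleStep-⊑⇔ (source s) (source-compact s) (target s) f

  ⟦⟧-compact : ∀ s → E^D.IsCompact ⟦ s ⟧
  ⟦⟧-compact s =
    singleStep-compact (source s) (source-compact s) (target s) (target-compact s)

  -- Algebraicity is used twice: `f` preserves the supremum of the basis elements `a` below `d`, and
  -- each `apply f a` is the supremum of the basis elements `b` below it. Each such pair is a step
  -- below `f`.
  ⊑-by-steps : ∀ f g → (∀ s → s Below f → s Below g) → f E^D.⊑ g
  ⊑-by-steps f g below d =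
    proj₂ (continuous f (members (D′.BasisBelow B-D-basis D-algebraic d))
            (D′.basis-directed B-D-basis D-algebraic d) d
            (D′.basis-lub B-D-basis D-algebraic d)) _
      λ (a , a⊑d , a∈B) → E.trans
        (proj₂ (E′.basis-lub B-E-basis E-algebraic (apply f a)) _
          λ (b , b⊑fa , b∈B) → below (step a a∈B b b∈B) b⊑fa)
        (scott-mono D E g a⊑d)

  -- Algebraicity of the exponential.

  algebraic : E^D.IsAlgebraic
  algebraic f = (bottom , semidirected) , (λ (_ , c⊑f , _) → c⊑f) , least
    where
    bottom : Σ E^D.Carrier (E^D.CompactBelow f)
    bottom = ⊥-E^D , (λ d → ⊥-minimum _)
           -- The bottom function is compact as the join of the empty family.
           , E^D.finite-lub-compact {x = ⊥-E^D} [] ((λ ()) , λ u _ d → ⊥-minimum _) (λ ())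

    semidirected : E^D.IsSemidirected (members (E^D.CompactBelow f))
    semidirected (g , g⊑f , g≪g) (h , h⊑f , h≪h) =
        (join F bounded , proj₂ (join-isLub F bounded) f (proj₂ bounded)
        , E^D.finite-lub-compact {x = join F bounded} F (join-isLub F bounded)
            λ { zero → g≪g ; (suc zero) → h≪h })
      , proj₁ (join-isLub F bounded) zero
      , proj₁ (join-isLub F bounded) (suc zero)
      where
      F : Fin 2 → E^D.Carrier
      F = g ∷ h ∷ []

      -- Since `f` bounds both functions, their join exists and remains below `f`.
      bounded : E^D.IsBounded F
      bounded = f , λ { zero → g⊑f ; (suc zero) → h⊑f }

    least : ∀ u → E^D.IsUpperBound u (members (E^D.CompactBelow f)) → f E^D.⊑ u
    least u bound = ⊑-by-steps f u λ s s-below-f →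
      to (⟦⟧⊑⇔Below s u)
         (bound (⟦ s ⟧ , from (⟦⟧⊑⇔Below s f) s-below-f , ⟦⟧-compact s))

  -- Compact elements as finite joins of single steps.

  IsFiniteStepJoin : E^D.Carrier → Set _
  IsFiniteStepJoin f = ∃[ n ] Σ[ s ∈ (Fin n → Step) ] E^D.IsLub f (⟦_⟧ ∘ s)

  -- Passing to enumerated codes lets later arguments run over `Fin n`. The enumeration and the
  -- codes are explicit data of `StepJoins`, so no choice is involved.
  StepJoins⇔ : ∀ f → f ∈ B ⇔ IsFiniteStepJoin f
  StepJoins⇔ f = mk⇔ StepJoins⇒ StepJoins⇐
    where
    StepJoins⇒ : f ∈ B → IsFiniteStepJoin f
    StepJoins⇒ (S , S-steps , (n , enum , enum∈S , enum-onto) , _ , upper , least) =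
        n , s
      , (λ k → E^D.trans {⟦ s k ⟧} {enum k} {f}
          (E^D.reflexive {⟦ s k ⟧} {enum k} (E^D.Eq.sym {enum k} {⟦ s k ⟧} (enum≈ k)))
          (upper (enum k , enum∈S k)))
      , λ u bound → least u λ (g , g∈S) →
          let k , enum-k≈g = enum-onto g g∈S
          in E^D.trans {g} {⟦ s k ⟧} {u}
               (E^D.reflexive {g} {⟦ s k ⟧}
                 (E^D.Eq.trans {g} {enum k} {⟦ s k ⟧}
                   (E^D.Eq.sym {enum k} {g} enum-k≈g) (enum≈ k)))
               (bound k)
      where
      s : Fin n → Step
      s k = let a , a∈B , b , b∈B , _ = S-steps (enum k) (enum∈S k) in step a a∈B b b∈B

      enum≈ : ∀ k → enum k E^D.≈ ⟦ s k ⟧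
      enum≈ k = let _ , _ , _ , _ , eq = S-steps (enum k) (enum∈S k) in eq

    StepJoins⇐ : IsFiniteStepJoin f → f ∈ B
    StepJoins⇐ (n , s , upper , least) =
        S
      , (λ g (k , g≈) → source (s k) , source∈B (s k) , target (s k) , target∈B (s k) , g≈)
      , ( n , ⟦_⟧ ∘ s
        , (λ k → k , E^D.Eq.refl {⟦ s k ⟧})
        , (λ g (k , g≈) → k , E^D.Eq.sym {g} {⟦ s k ⟧} g≈))
      , (f , S⊑f)
      , S⊑f
      , λ u bound → least u λ k → bound (⟦ s k ⟧ , k , E^D.Eq.refl {⟦ s k ⟧})
      where
      -- Pointwise equality keeps this predicate in `Set v`; propositional equality on the carrier
      -- would land in `Set (suc v)`.
      S : Pred E^D.Carrier v
      S g = ∃[ k ] g E^D.≈ ⟦ s k ⟧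

      S⊑f : E^D.IsUpperBound f (members S)
      S⊑f (g , k , g≈) =
        E^D.trans {g} {⟦ s k ⟧} {f} (E^D.reflexive {g} {⟦ s k ⟧} g≈) (upper k)

  -- Compactness is applied to the joins of finite lists of steps below `f`. One such join lies
  -- above `f`, while every step in its list lies below `f`, so `f` is the supremum of that list.
  compact⇒finiteStepJoin : ∀ f → E^D.IsCompact f → IsFiniteStepJoin f
  compact⇒finiteStepJoin f f≪f =
    let (n , s) , f⊑join = f≪f joins joins-directed f⊑⋁joins
    in n , proj₁ ∘ s , proj₂ (bounded s)
     , λ u bound → E^D.trans {f} {joins (n , s)} {u}
         f⊑join (proj₂ (joins-isLub s) u bound)
    where
    StepBelow : Set v
    StepBelow = Σ[ s ∈ Step ] s Below f

    ⟦_⟧ᵇ : StepBelow → E^D.Carrier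
    ⟦ s , _ ⟧ᵇ = ⟦ s ⟧

    ⟦⟧ᵇ-reflexive : ∀ {r s} → r ≡ s → ⟦ r ⟧ᵇ E^D.⊑ ⟦ s ⟧ᵇ
    ⟦⟧ᵇ-reflexive r≡s d = E.reflexive (E.Eq.reflexive (cong (λ r → apply ⟦ r ⟧ᵇ d) r≡s))

    bounded : ∀ {n} (s : Fin n → StepBelow) → E^D.IsBounded (⟦_⟧ᵇ ∘ s)
    bounded s = f , λ k → from (⟦⟧⊑⇔Below (proj₁ (s k)) f) (proj₂ (s k))

    joins : Σ[ n ∈ ℕ ] (Fin n → StepBelow) → E^D.Carrier
    joins (n , s) = join (⟦_⟧ᵇ ∘ s) (bounded s)

    joins-isLub : ∀ {n} (s : Fin n → StepBelow) → E^D.IsLub (joins (n , s)) (⟦_⟧ᵇ ∘ s)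
    joins-isLub s = join-isLub (⟦_⟧ᵇ ∘ s) (bounded s)

    joins-directed : E^D.IsDirected joins
    -- The empty list gives an inhabitant and concatenation an upper bound. Lookups in `s ++ t` are
    -- known only up to propositional equality, hence `⟦⟧ᵇ-reflexive`.
    joins-directed = (0 , []) , λ (m , s) (n , t) →
      let s++t-upper = proj₁ (joins-isLub (s ++ t)) in
        (m + n , s ++ t)
      , proj₂ (joins-isLub s) (joins (m + n , s ++ t)) (λ k →
          E^D.trans {⟦ s k ⟧ᵇ} {⟦ (s ++ t) (k ↑ˡ n) ⟧ᵇ} {joins (m + n , s ++ t)}
            (⟦⟧ᵇ-reflexive (sym (lookup-++ˡ s t k))) (s++t-upper (k ↑ˡ n)))
      , proj₂ (joins-isLub t) (joins (m + n , s ++ t)) (λ k →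
          E^D.trans {⟦ t k ⟧ᵇ} {⟦ (s ++ t) (m ↑ʳ k) ⟧ᵇ} {joins (m + n , s ++ t)}
            (⟦⟧ᵇ-reflexive (sym (lookup-++ʳ s t k))) (s++t-upper (m ↑ʳ k)))

    f⊑⋁joins : f E^D.⊑ E^D.⋁ joins joins-directed
    f⊑⋁joins = ⊑-by-steps f (E^D.⋁ joins joins-directed) λ s s-below-f →
      -- One-element lists already place every step below `f` under the supremum.
      let t = (s , s-below-f) ∷ [] in
      to (⟦⟧⊑⇔Below s (E^D.⋁ joins joins-directed))
         (E^D.trans {⟦ s ⟧} {joins (1 , t)} {E^D.⋁ joins joins-directed}
            (proj₁ (joins-isLub t) zero)
            (proj₁ (E^D.⋁-isLub joins joins-directed) (1 , t)))

  basis : E^D.IsCompactBasis B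
  basis f = mk⇔ B⇒compact compact⇒B
    where
    B⇒compact : f ∈ B → E^D.IsCompact f
    B⇒compact f∈B =
      let n , s , f-lub = to (StepJoins⇔ f) f∈B
      in E^D.finite-lub-compact {x = f} (⟦_⟧ ∘ s) f-lub (λ k → ⟦⟧-compact (s k))

    compact⇒B : E^D.IsCompact f → f ∈ B
    compact⇒B f≪f = from (StepJoins⇔ f) (compact⇒finiteStepJoin f f≪f)

  -- Decidability on the basis.

  lub-of-steps-⊑⇔ : ∀ {n} (s : Fin n → Step) f g → E^D.IsLub f (⟦_⟧ ∘ s) →
                    (∀ k → s k Below g) ⇔ f E^D.⊑ g
  lub-of-steps-⊑⇔ s f g (upper , least) = mk⇔
    (λ below → least g λ k → from (⟦⟧⊑⇔Below (s k) g) (below k))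
    (λ f⊑g k → to (⟦⟧⊑⇔Below (s k) g) (E^D.trans {⟦ s k ⟧} {f} {g} (upper k) f⊑g))

  -- The bottom function is constantly `⊥-E`, so `f` equals it exactly when each of the finitely
  -- many targets equals `⊥-E`.
  ≈⊥-decidable : (∀ b → b ∈ B-E → Dec (b E.≈ ⊥-E)) → ∀ f → f ∈ B → Dec (f E^D.≈ ⊥-E^D)
  ≈⊥-decidable ≈⊥? f f∈B =
    let n , s , f-lub = to (StepJoins⇔ f) f∈B
        ⊑⊥⇔ = lub-of-steps-⊑⇔ s f ⊥-E^D f-lub
    in map (mk⇔
         (λ targets≈⊥ d →
           E.antisym (to ⊑⊥⇔ (E.reflexive ∘ targets≈⊥) d) (⊥-minimum _))
         (λ f≈⊥ k →
           E.antisym (from ⊑⊥⇔ (E.reflexive ∘ f≈⊥) k) (⊥-minimum _)))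
       (all? λ k → ≈⊥? (target (s k)) (target∈B (s k)))

  module _ (_⊑ᴰ?_ : DecidableOn B-D D._⊑_) where

    -- This makes `apply g (source (s k))` an element on which the decision procedure for `B-E` can
    -- be run.
    value∈B : ∀ f → f ∈ B → ∀ a → a ∈ B-D → apply f a ∈ B-E
    value∈B f f∈B a a∈B =
      let n , s , f-lub = to (StepJoins⇔ f) f∈B in
      from (B-E-basis (apply f a))
        (E′.finite-lub-compact (λ k → apply ⟦ s k ⟧ a)
          (lub-pointwise (⟦_⟧ ∘ s) (f , proj₁ f-lub) {f} f-lub a)
          λ k → stepValue-compact (source (s k)) (target (s k)) a
                  ((source (s k) ⊑ᴰ? a) (source∈B (s k)) a∈B) (target-compact (s k)))

    ⊑-decidable : DecidableOn B-E E._⊑_ → DecidableOn B E^D._⊑_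
    ⊑-decidable _⊑ᴱ?_ f g f∈B g∈B =
      let n , s , f-lub = to (StepJoins⇔ f) f∈B in
      map (lub-of-steps-⊑⇔ s f g f-lub) (all? λ k →
        (target (s k) ⊑ᴱ? apply g (source (s k)))
          (target∈B (s k)) (value∈B g g∈B (source (s k)) (source∈B (s k))))

proposition2p31 :
  ∀ {v : Level} (D E : DCPO v v) →
  let module D = DCPO D
      module E = DCPO E
      module E^D = DCPO (E ^ D)
  in
  D.Carrier →
  D.IsAlgebraic →
  (B-D : Pred D.Carrier v) (B-D-basis : D.IsCompactBasis B-D) →
  (E-pointed : E.IsPointed) →
  E.IsBoundedComplete →
  E.IsAlgebraic →
  (B-E : Pred E.Carrier v) (B-E-basis : E.IsCompactBasis B-E) →
  let B = StepJoins D E E-pointed B-D B-D-basis B-E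
      ⊥-E = proj₁ E-pointed
      ⊥-E^D = proj₁ (^-pointed E D E-pointed)
  in
  E^D.IsAlgebraic
  × E^D.IsCompactBasis B
  × ((∀ b → b ∈ B-E → Dec (b E.≈ ⊥-E)) → ∀ f → f ∈ B → Dec (f E^D.≈ ⊥-E^D))
  × (DecidableOn B-D D._⊑_ ⇔ DecidableOn B-D D._≪_)
  × (DecidableOn B-E E._⊑_ ⇔ DecidableOn B-E E._≪_)
  × (DecidableOn B-D D._⊑_ → DecidableOn B-E E._⊑_ →
       DecidableOn B E^D._⊑_ × DecidableOn B E^D._≪_)
proposition2p31 D E _ D-algebraic B-D B-D-basis E-pointed E-boundedComplete
                E-algebraic B-E B-E-basis =
    algebraic
  , basis
  , ≈⊥-decidable
  , DCPOProperties.decidable-⊑⇔≪ D B-D B-D-basis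
  , DCPOProperties.decidable-⊑⇔≪ E B-E B-E-basis
  , λ ⊑ᴰ? ⊑ᴱ? →
      ⊑-decidable ⊑ᴰ? ⊑ᴱ?
    -- By `basis` the elements of `B` are compact, so `⊑` and `≪` agree on them.
    , to (DCPOProperties.decidable-⊑⇔≪ (E ^ D) _ basis) (⊑-decidable ⊑ᴰ? ⊑ᴱ?)
  where
  open Exponential D E D-algebraic B-D B-D-basis E-pointed E-boundedComplete
                   E-algebraic B-E B-E-basis
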